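{- Let $(\mathcal{F},\mathsf{B})$ be a position which, for some positive integer $n$, is isomorphic to the position $(\mathcal{G}_n,\mathsf{A}_n)$. (1) If $n$ is odd then $(\mathcal{F},\mathsf{B})$ is an $\mathsf{N}$-position. (2) If $n$ is even then $(\mathcal{F},\mathsf{B})$ is a $\mathsf{P}$-position.
   Context: **The graphs $\mathcal{G}_n$ and sets $\mathsf{A}_n$.** $\mathcal{G}_1$ is the triangle with vertex set $\{1,2,3\}$ and edges $\{1,2\},\{1,3\},\{2,3\}$. Given $\mathcal{G}_n=(V_n,E_n)$ with $V_n=\{1,2,\dots,2n+1\}$, the graph $\mathcal{G}_{n+1}=(V_{n+1},E_{n+1})$ has $V_{n+1}=V_n\cup\{2n+2,2n+3\}$ and $E_{n+1}=E_n\cup\{\{2n+1,2n+2\},\{2n+1,2n+3\},\{2n+2,2n+3\}\}$. For each $n$, $\mathsf{A}_n=\{2\}\cup\{k\in V_n : k \bmod 4=0\}$. **The graph transformation gcds.** Let $\mathcal{G}=(V,E)$ be a graph and $\{x,y\}\in E$. The master list of $\{x,y\}$ has two columns: the first consists of all neighbors of $x$ in $\mathcal{G}$ except $y$, the second of all neighbors of $y$ in $\mathcal{G}$ except $x$. The graph $\mathbf{gcds}(\mathcal{G},\{x,y\})=(V,E')$ is defined as follows. Both $x$ and $y$ are isolated in it. For $p\ne q$ in $V\setminus\{x,y\}$: (a) if $p$ or $q$ is not in the master list, then $\{p,q\}\in E'$ iff $\{p,q\}\in E$; (b) if both are in the master list, then: (b.1) if no column contains both $p$ and $q$, then $\{p,q\}\in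 E'$ iff $\{p,q\}\notin E$; (b.2) if some column contains both and the total number of occurrences of $p$ and $q$ in the master list (both columns together) is even, then $\{p,q\}\in E'$ iff $\{p,q\}\in E$; (b.3) if some column contains both and that total number is odd, then $\{p,q\}\in E'$ iff $\{p,q\}\notin E$. **The modification $\mathbf{gcds}_2$.** For a finite graph $\mathcal{G}=(V,E)$ and $\{a,b\}\in E$, compute $(V,E')=\mathbf{gcds}(\mathcal{G},\{a,b\})$; then delete $a$ and $b$, and also delete every vertex $v$ in the master list of $\{a,b\}$ that is isolated in $(V,E')$, unless $v$ is the only vertex in the master list. With $V'$ the set of remaining vertices, $\mathbf{gcds}_2(\mathcal{G},\{a,b\})=(V',E')$. **The game and positions.** A position is a pair $(\mathcal{G},\mathsf{A})$ with $\mathcal{G}=(V,E)$ a finite graph and $\mathsf{A}$ a set (the vertices favorable to player ONE). From a position, players ONE and TWO alternate moves; a move consists of choosing an edge $\{a,b\}$ of the current graph $\mathcal{C}$ and replacing $\mathcal{C}$ by $\mathbf{gcds}_2(\mathcal{C},\{a,b\})$. Play ends when the current graph has no edges. If the vertex set of the final graph is nonempty and is a subset of $\mathsf{A}$, then ONE wins; otherwise TWO wins. (The game $\mathsf{GCDS}(\mathcal{G},\mathsf{A})$ is this game with ONE moving first.) Positions $(\mathcal{F}_1,\mathsf{B}_1)$ and $(\mathcal{F}_2,\mathsf{B}_2)$ are isomorphic if there is a graph isomorphism $f$ from $\mathcal{F}_1$ to $\mathcal{F}_2$ with $\mathsf{B}_2=\{f(b): b\in\mathsf{B}_1\}$. A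 position is a $\mathsf{P}$-position if the player whose move produced it (i.e. the player who is not next to move) has a winning strategy from it; it is an $\mathsf{N}$-position if the next player to move has a winning strategy from it. Both notions are understood for either choice of which of ONE, TWO is the next player to move. -}

module Defs where

open import Data.Bool using (Bool; true; false; T; T?; not; if_then_else_; _∧_; _∨_)
open import Data.Bool.Properties using (∧-comm)
open import Data.List using (List; []; _∷_; _++_; length; filter; applyUpTo)
open import Data.List.Membership.Propositional using (_∈_)
open import Data.List.Membership.Propositional.Properties using (∈-filter⁺; ∈-filter⁻; ∈-applyUpTo⁺; ∈-++⁻)
import Data.List.Membership.DecPropositional as DecMembership
open import Data.List.Relation.Unary.All using (All; all?; lookup)
open import Data.List.Relation.Unary.Any using (here; there)
open import Data.List.Relation.Unary.Unique.Propositional using (Unique)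
import Data.List.Relation.Unary.Unique.Propositional.Properties as Unique
open import Data.Nat using (ℕ; zero; suc; _+_; _*_; _%_; _≤_; z≤n; s≤s; NonZero)
import Data.Nat.Properties as ℕ
open import Data.Nat.Tactic.RingSolver using (solve-∀)
open import Data.Nat.Properties using (+-comm)
open import Data.Nat.Divisibility using (_∣_; _∣?_)
open import Data.Product using (Σ; ∃-syntax; _×_; _,_; proj₁; proj₂; map; map₂)
open import Data.Sum using (_⊎_; inj₁; inj₂; [_,_]′)
open import Function using (_∘_)
open import Function.Bundles using (_↔_; _⇔_; Inverse)
open import Level using (0ℓ)
open import Relation.Binary using (DecidableEquality)
open import Relation.Binary.PropositionalEquality
  using (_≡_; _≢_; refl; sym; cong; cong₂; subst)
open import Relation.Nullary using (¬_; Dec; yes; no; does; ¬?; contradiction)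
open import Relation.Nullary.Decidable using (_×-dec_; _⊎-dec_; dec-true)
open import Relation.Unary using (Pred)

private
  ≟-sym : {A : Set} (_≟_ : DecidableEquality A) → ∀ p q → does (p ≟ q) ≡ does (q ≟ p)
  ≟-sym _≟_ p q with p ≟ q | q ≟ p
  ... | yes _  | yes _  = refl
  ... | no  _  | no  _  = refl
  ... | yes eq | no neq = contradiction (sym eq) neq
  ... | no neq | yes eq = contradiction (sym eq) neq

-- Finite simple graphs.  Vertices are drawn from an ambient type, so that
-- deleting vertices does not rename the remaining ones and the set of favorable
-- vertices stays meaningful throughout a play.
record Graph (U : Set) : Set where
  infix 4 _≟_
  field
    _≟_         : DecidableEquality U
    vertices    : List U
    unique      : Unique vertices
    adjacent    : U → U → Bool
    symmetric   : ∀ x y → adjacent x y ≡ adjacent y x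
    irreflexive : ∀ x → adjacent x x ≡ false
    incident    : ∀ x y → T (adjacent x y) → x ∈ vertices

  open DecMembership _≟_ public using (_∈?_)

  Edge : U → U → Set
  Edge x y = T (adjacent x y)

  Vertex : Set
  Vertex = Σ U (_∈ vertices)

open Graph using (Edge; Vertex; vertices)

module _ {U : Set} (G : Graph U) where
  open Graph G hiding (Edge; Vertex; vertices)

  Isolated : Pred U 0ℓ
  Isolated v = All (λ w → ¬ Edge G v w) (vertices G)

  isolated? : ∀ v → Dec (Isolated v)
  isolated? v = all? (λ w → ¬? (T? (adjacent v w))) (vertices G)

  column : U → U → List U
  column x y = filter (λ v → T? (adjacent x v) ×-dec ¬? (v ≟ y)) (vertices G)

  masterList : U → U → List U
  masterList x y = column x y ++ column y x

  occurrences : U → List U → ℕ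
  occurrences p vs = length (filter (p ≟_) vs)

  module _ (x y : U) where

    endpoint left right listed : U → Bool
    endpoint v = does ((v ≟ x) ⊎-dec (v ≟ y))
    left     v = does (v ∈? column x y)
    right    v = does (v ∈? column y x)
    listed   v = does (v ∈? masterList x y)

    -- The first test makes x and y isolated and excludes loops; the others are
    -- the cases (a), (b.1), (b.2), (b.3), in this order.
    gcdsAdjacent : U → U → Bool
    gcdsAdjacent p q =
      if endpoint p ∨ endpoint q ∨ does (p ≟ q) then false
      else if not (listed p ∧ listed q) then adjacent p q
      else if not ((left p ∧ left q) ∨ (right p ∧ right q)) then not (adjacent p q)
      else if does (2 ∣? (occurrences p (masterList x y) + occurrences q (masterList x y)))
        then adjacent p q
        else not (adjacent p q)

    private
      ∨-swap : ∀ a b {c d} → c ≡ d → a ∨ b ∨ c ≡ b ∨ a ∨ d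
      ∨-swap false false eq = eq
      ∨-swap false true  _  = refl
      ∨-swap true  false _  = refl
      ∨-swap true  true  _  = refl

      if-cong : {A : Set} {b c : Bool} {t u e f : A} → b ≡ c → t ≡ u → e ≡ f →
                (if b then t else e) ≡ (if c then u else f)
      if-cong refl refl refl = refl

      gcds-symmetric : ∀ p q → gcdsAdjacent p q ≡ gcdsAdjacent q p
      gcds-symmetric p q =
        if-cong (∨-swap (endpoint p) (endpoint q) (≟-sym _≟_ p q)) refl
        (if-cong (cong not (∧-comm (listed p) (listed q))) (symmetric p q)
        (if-cong (cong not (cong₂ _∨_ (∧-comm (left p) (left q))
                                      (∧-comm (right p) (right q))))
                 (cong not (symmetric p q))
        (if-cong (cong (λ k → does (2 ∣? k))
                       (+-comm (occurrences p (masterList x y))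
                               (occurrences q (masterList x y))))
                 (symmetric p q) (cong not (symmetric p q)))))

      gcds-irreflexive : ∀ p → gcdsAdjacent p p ≡ false
      gcds-irreflexive p with endpoint p
      ... | true  = refl
      ... | false rewrite dec-true (p ≟ p) refl = refl

      column⊆ : ∀ a b {v} → v ∈ column a b → v ∈ vertices G
      column⊆ a b v∈ =
        proj₁ (∈-filter⁻ (λ v → T? (adjacent a v) ×-dec ¬? (v ≟ b)) {xs = vertices G} v∈)

      adjacent-or-listed : ∀ b l m {a e} →
        T (if b then false else if not (l ∧ m) then a else e) → T a ⊎ T l
      adjacent-or-listed false false _     t = inj₁ t
      adjacent-or-listed false true  false t = inj₁ t
      adjacent-or-listed false true  true  _ = inj₂ _

      gcds-incident : ∀ p q → T (gcdsAdjacent p q) → p ∈ vertices G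
      gcds-incident p q t
        with adjacent-or-listed (endpoint p ∨ endpoint q ∨ does (p ≟ q)) (listed p) (listed q) t
      ... | inj₁ e = incident p q e
      ... | inj₂ l with p ∈? masterList x y
      ...   | yes p∈ = [ column⊆ x y , column⊆ y x ]′ (∈-++⁻ (column x y) p∈)

    gcds : Graph U
    gcds = record
      { _≟_         = _≟_
      ; vertices    = vertices G
      ; unique      = unique
      ; adjacent    = gcdsAdjacent
      ; symmetric   = gcds-symmetric
      ; irreflexive = gcds-irreflexive
      ; incident    = gcds-incident
      }

module _ {U : Set} (G : Graph U) (a b : U) where
  open Graph G using (_≟_; _∈?_)

  private
    H : Graph U
    H = gcds G a b

  Deleted : Pred U 0ℓ
  Deleted v = (v ≡ a ⊎ v ≡ b) ⊎
              (v ∈ masterList G a b × Isolated H v × ¬ All (_≡ v) (masterList G a b))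

  deleted? : ∀ v → Dec (Deleted v)
  deleted? v = ((v ≟ a) ⊎-dec (v ≟ b)) ⊎-dec
               ((v ∈? masterList G a b) ×-dec isolated? H v
                 ×-dec ¬? (all? (_≟ v) (masterList G a b)))

  private
    edge⇒¬deleted : ∀ p q → Edge H p q → ¬ Deleted p
    edge⇒¬deleted p q e (inj₁ p≡)
      rewrite dec-true ((p ≟ a) ⊎-dec (p ≟ b)) p≡ = e
    edge⇒¬deleted p q e (inj₂ (_ , isolated , _)) =
      lookup isolated
        (Graph.incident H q p (subst T (Graph.symmetric H p q) e)) e

  -- Deleted vertices are isolated in gcds G a b, so its edge set needs no
  -- restriction to the remaining vertices.
  gcds₂ : Graph U
  gcds₂ = record H
    { vertices = filter (λ v → ¬? (deleted? v)) (vertices G)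
    ; unique   = Unique.filter⁺ (λ v → ¬? (deleted? v)) (Graph.unique G)
    ; incident = λ p q e →
        ∈-filter⁺ (λ v → ¬? (deleted? v)) (Graph.incident H p q e) (edge⇒¬deleted p q e)
    }

data Player : Set where
  ONE TWO : Player

opponent : Player → Player
opponent ONE = TWO
opponent TWO = ONE

Position : Set → Set₁
Position U = Graph U × Pred U 0ℓ

module _ {U : Set} where

  Edgeless : Graph U → Set
  Edgeless G = ∀ a b → ¬ Edge G a b

  Wins : Player → Position U → Set
  Wins ONE (C , A) = vertices C ≢ [] × All A (vertices C)
  Wins TWO final   = ¬ Wins ONE final

  -- WinningStrategy p next (C , A): strategies that win for p from the
  -- position (C , A) with player next to move.  Such a strategy is a tree: it
  -- chooses one edge when p is to move and has a continuation for every edge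
  -- when the opponent is.  Every move removes vertices, so plays are finite.
  data WinningStrategy (p : Player) : Player → Position U → Set₁ where
    finished : ∀ {next C A} → Edgeless C → Wins p (C , A) →
               WinningStrategy p next (C , A)
    choose   : ∀ {C A} a b → Edge C a b →
               WinningStrategy p (opponent p) (gcds₂ C a b , A) →
               WinningStrategy p p (C , A)
    respond  : ∀ {C A} → ¬ Edgeless C →
               (∀ a b → Edge C a b → WinningStrategy p p (gcds₂ C a b , A)) →
               WinningStrategy p (opponent p) (C , A)

  P-position N-position : Position U → Set₁
  P-position pos = ∀ next → WinningStrategy (opponent next) next pos
  N-position pos = ∀ next → WinningStrategy next next pos

record _≅_ {U W : Set} (pos₁ : Position U) (pos₂ : Position W) : Set where
  G₁ = proj₁ pos₁
  B₁ = proj₂ pos₁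
  G₂ = proj₁ pos₂
  B₂ = proj₂ pos₂
  field
    bijection : Vertex G₁ ↔ Vertex G₂

  f : Vertex G₁ → Vertex G₂
  f = Inverse.to bijection

  field
    edges     : ∀ u v → Edge G₁ (proj₁ u) (proj₁ v) ⇔ Edge G₂ (proj₁ (f u)) (proj₁ (f v))
    -- B₂ is the image of B₁ under f, which is defined on vertices only.
    favorable : ∀ w → B₂ w ⇔ (∃[ b ] B₁ (proj₁ b) × proj₁ (f b) ≡ w)

module _ where
  open DecMembership ℕ._≟_ using (_∈?_)

  corners : ℕ → List ℕ
  corners c = c ∷ c + 1 ∷ c + 2 ∷ []

  triangle : ℕ → ℕ → ℕ → Bool
  triangle c p q = does (p ∈? corners c) ∧ does (q ∈? corners c) ∧ not (does (p ℕ.≟ q))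

  𝒢-adjacent : (n : ℕ) .{{_ : NonZero n}} → ℕ → ℕ → Bool
  𝒢-adjacent (suc zero)      p q = triangle 1 p q
  𝒢-adjacent (suc n@(suc _)) p q = 𝒢-adjacent n p q ∨ triangle (2 * n + 1) p q

  private
    ∧-swap : ∀ a b {c d} → c ≡ d → a ∧ b ∧ not c ≡ b ∧ a ∧ not d
    ∧-swap false false _  = refl
    ∧-swap false true  _  = refl
    ∧-swap true  false _  = refl
    ∧-swap true  true  eq = cong not eq

    triangle-symmetric : ∀ c p q → triangle c p q ≡ triangle c q p
    triangle-symmetric c p q =
      ∧-swap (does (p ∈? corners c)) (does (q ∈? corners c)) (≟-sym ℕ._≟_ p q)

    ∧-irreflexive : ∀ a {b} → b ≡ true → a ∧ a ∧ not b ≡ false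
    ∧-irreflexive false _    = refl
    ∧-irreflexive true  refl = refl

    triangle-irreflexive : ∀ c p → triangle c p p ≡ false
    triangle-irreflexive c p =
      ∧-irreflexive (does (p ∈? corners c)) (dec-true (p ℕ.≟ p) refl)

    𝒢-symmetric : ∀ n .{{_ : NonZero n}} p q → 𝒢-adjacent n p q ≡ 𝒢-adjacent n q p
    𝒢-symmetric (suc zero)      p q = triangle-symmetric 1 p q
    𝒢-symmetric (suc n@(suc _)) p q =
      cong₂ _∨_ (𝒢-symmetric n p q) (triangle-symmetric (2 * n + 1) p q)

    𝒢-irreflexive : ∀ n .{{_ : NonZero n}} p → 𝒢-adjacent n p p ≡ false
    𝒢-irreflexive (suc zero)      p = triangle-irreflexive 1 p
    𝒢-irreflexive (suc n@(suc _)) p =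
      cong₂ _∨_ (𝒢-irreflexive n p) (triangle-irreflexive (2 * n + 1) p)

    witness : {P : Set} (P? : Dec P) {b : Bool} → T (does P? ∧ b) → P
    witness (yes p) _ = p

    corner-bounds : ∀ c p → p ∈ corners c → c ≤ p × p ≤ c + 2
    corner-bounds c _ (here refl)                 = ℕ.≤-refl , ℕ.m≤m+n c 2
    corner-bounds c _ (there (here refl))         = ℕ.m≤m+n c 1 , ℕ.+-monoʳ-≤ c (s≤s z≤n)
    corner-bounds c _ (there (there (here refl))) = ℕ.m≤m+n c 2 , ℕ.≤-refl

    triangle-bounds : ∀ c p q → T (triangle c p q) → c ≤ p × p ≤ c + 2
    triangle-bounds c p q t = corner-bounds c p (witness (p ∈? corners c) t)

    split : ∀ a {b} → T (a ∨ b) → T a ⊎ T b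
    split true  _ = inj₁ _
    split false t = inj₂ t

    next-bound : ∀ n → 2 * n + 1 + 2 ≡ 2 * suc n + 1
    next-bound = solve-∀

    𝒢-bounds : ∀ n .{{_ : NonZero n}} p q → T (𝒢-adjacent n p q) → 1 ≤ p × p ≤ 2 * n + 1
    𝒢-bounds (suc zero)      p q t = triangle-bounds 1 p q t
    𝒢-bounds (suc n@(suc _)) p q t =
      [ map₂ (λ p≤ → ℕ.≤-trans p≤ (ℕ.≤-trans (ℕ.m≤m+n (2 * n + 1) 2) 2n+3≤)) ∘ 𝒢-bounds n p q
      , map (ℕ.≤-trans (ℕ.m≤n+m 1 (2 * n))) (λ p≤ → ℕ.≤-trans p≤ 2n+3≤)
          ∘ triangle-bounds (2 * n + 1) p q
      ]′ (split (𝒢-adjacent n p q) t)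
      where 2n+3≤ = ℕ.≤-reflexive (next-bound n)

    𝒢-incident : ∀ n .{{_ : NonZero n}} p q → T (𝒢-adjacent n p q) → p ∈ applyUpTo suc (2 * n + 1)
    𝒢-incident n p q t with p | 𝒢-bounds n p q t
    ... | suc i | _ , i< = ∈-applyUpTo⁺ suc i<

  𝒢 : (n : ℕ) .{{_ : NonZero n}} → Graph ℕ
  𝒢 n = record
    { _≟_         = ℕ._≟_
    ; vertices    = applyUpTo suc (2 * n + 1)
    ; unique      = Unique.applyUpTo⁺₁ suc (2 * n + 1) (λ i<j _ → ℕ.<⇒≢ (s≤s i<j))
    ; adjacent    = 𝒢-adjacent n
    ; symmetric   = 𝒢-symmetric n
    ; irreflexive = 𝒢-irreflexive n
    ; incident    = 𝒢-incident n
    }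

  𝖠 : (n : ℕ) .{{_ : NonZero n}} → Pred ℕ 0ℓ
  𝖠 n k = k ≡ 2 ⊎ (k ∈ vertices (𝒢 n) × k % 4 ≡ 0)

{-# OPTIONS --safe #-}
module Submission where

-- Over GF(2), gcds is pivoting (a Schur complement) of the adjacency matrix.
-- 𝒢 n is the line graph of a caterpillar whose spine edges are the odd labels, and
-- there the pivot contracts two adjacent tree edges.  So a position is described by
-- the increasing word of surviving labels: two labels are adjacent iff no odd label
-- survives strictly between them, and a move deletes two adjacent labels.  Labels
-- consecutive in the word are adjacent, so no vertex is isolated until one is left
-- and every play has exactly n moves.
--
-- The player who makes the last move wins.  TWO does so by counting: he deletes a
-- favorable vertex in each move as long as there is one, so at most two are in the last
-- triangle.  ONE answers every move of TWO so as to turn the word of 𝒢 n into that of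
-- 𝒢 (n - 2), up to the parity of its two end labels; for odd n she first deletes the
-- last two labels.

open import Defs
open import Data.Bool using (Bool; true; false; T; T?; not; if_then_else_; _∧_; _∨_; _xor_)
open import Data.Bool.Properties
  using (T-≡; ∧-zeroʳ; ∧-identityʳ; ∨-identityʳ; ∨-assoc; not-involutive; xor-comm)
open import Data.Bool.Solver using (module xor-∧-Solver)
open import Data.Empty using (⊥)
open import Data.List using (List; []; _∷_; _++_; length; filter; applyUpTo)
open import Data.List.Properties using (length-++; filter-++; filter-accept; filter-reject; filter-none)
open import Data.List.Membership.Propositional using (_∈_)
open import Data.List.Membership.Propositional.Properties
  using (∈-filter⁺; ∈-filter⁻; ∈-++⁺ˡ; ∈-++⁺ʳ; ∈-++⁻)
open import Data.List.Membership.Propositional.Properties.WithK using (unique⇒irrelevant)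
import Data.List.Membership.DecPropositional as DecMembership
open import Data.List.Relation.Binary.Permutation.Propositional
  using (_↭_; prep; swap; ↭-refl; ↭-sym; ↭-trans; ↭⇒↭ₛ)
open import Data.List.Relation.Binary.Permutation.Propositional.Properties using (∈-resp-↭; ↭-length)
import Data.List.Relation.Binary.Permutation.Setoid.Properties as Permutationₛ
open import Data.List.Relation.Unary.All as All using (_∷_; lookup)
open import Data.List.Relation.Unary.AllPairs using (_∷_)
open import Data.List.Relation.Unary.Any using (here; there)
open import Data.List.Relation.Unary.Unique.Propositional using (Unique)
import Data.List.Relation.Unary.Unique.Propositional.Properties as Unique
open import Data.Nat as ℕ using (ℕ; zero; suc; _+_; _*_; _%_; _<_; NonZero)
open import Data.Nat.Divisibility using (_∣_; _∤_; _∣?_; divides; ∣m+n∣m⇒∣n; ∣1⇒≡1)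
open import Data.Nat.DivMod using (m*n%n≡0; [m+kn]%n≡m%n)
import Data.Nat.Properties as ℕ
open import Data.Nat.Tactic.RingSolver using (solve-∀)
open import Data.Product using (∃-syntax; _×_; _,_; proj₁; proj₂)
open import Data.Sum using (_⊎_; inj₁; inj₂)
open import Function using (_∘_; _$_)
open import Function.Bundles using (mk⇔; Inverse; Equivalence)
open import Level using (0ℓ)
open import Relation.Binary using (DecidableEquality)
open import Relation.Binary.PropositionalEquality
  using (_≡_; _≢_; refl; sym; trans; cong; cong₂; subst; setoid; module ≡-Reasoning)
open import Relation.Nullary using (¬_; yes; no; does; ¬?; contradiction)
open import Relation.Nullary.Decidable using (dec-false; does-⇔; _⊎-dec_; _×-dec_)
open import Relation.Unary using (Pred)

open xor-∧-Solver using (solve; _:=_; _:+_; _:*_; con)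

-- The transformation gcds as a pivot over GF(2).

bit : Bool → ℕ
bit b = if b then 1 else 0

-- l, r (and l′, r′) say whether a vertex occurs in the left and in the right column.
pivot-table : ∀ l r l′ r′ e →
  (if not ((l ∨ r) ∧ (l′ ∨ r′)) then e
   else if not ((l ∧ l′) ∨ (r ∧ r′)) then not e
   else if does (2 ∣? ((bit l + bit r) + (bit l′ + bit r′))) then e else not e)
  ≡ ((l ∧ r′) xor (r ∧ l′)) xor e
pivot-table false false _ _ _ = refl
pivot-table false true  false false _ = refl
pivot-table false true  false true  _ = refl
pivot-table false true  true  false _ = refl
pivot-table false true  true  true  _ = refl
pivot-table true  false false false _ = refl
pivot-table true  false false true  _ = refl
pivot-table true  false true  false _ = refl
pivot-table true  false true  true  _ = refl
pivot-table true  true  false false _ = refl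
pivot-table true  true  false true  _ = refl
pivot-table true  true  true  false _ = refl
pivot-table true  true  true  true  _ = refl

module _ {U : Set} (C : Graph U) where
  open Graph C hiding (Edge; Vertex)

  ∈-column : ∀ {x y v} → T (adjacent x v) → v ≢ y → v ∈ column C x y
  ∈-column {x} {y} {v} e v≢y =
    ∈-filter⁺ (λ v → T? (adjacent x v) ×-dec ¬? (v ≟ y))
      (incident v x (subst T (symmetric x v) e)) (e , v≢y)

  column-∈ : ∀ {x y v} → v ∈ column C x y → v ∈ vertices × T (adjacent x v) × v ≢ y
  column-∈ {x} {y} = ∈-filter⁻ (λ v → T? (adjacent x v) ×-dec ¬? (v ≟ y)) {xs = vertices}

  column-unique : ∀ x y → Unique (column C x y)
  column-unique x y = Unique.filter⁺ (λ v → T? (adjacent x v) ×-dec ¬? (v ≟ y)) unique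

  does-∈-column : ∀ {x y v} → v ≢ y → does (v ∈? column C x y) ≡ adjacent x v
  does-∈-column {x} {y} {v} v≢y =
    does-⇔ (mk⇔ (proj₁ ∘ proj₂ ∘ column-∈) (λ e → ∈-column e v≢y))
      (v ∈? column C x y) (T? (adjacent x v))

  occurrences-∈ : ∀ {p xs} → Unique xs → p ∈ xs → occurrences C p xs ≡ 1
  occurrences-∈ {p} (fresh ∷ _) (here refl) =
    trans (cong length (filter-accept (p ≟_) refl))
      (cong (λ ys → length (p ∷ ys)) (filter-none (p ≟_) fresh))
  occurrences-∈ {p} (fresh ∷ uniq) (there p∈) =
    trans (cong length (filter-reject (p ≟_) (lookup fresh p∈ ∘ sym))) (occurrences-∈ uniq p∈)

  occurrences-unique : ∀ {p xs} → Unique xs → occurrences C p xs ≡ bit (does (p ∈? xs))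
  occurrences-unique {p} {xs} uniq with p ∈? xs
  ... | yes p∈ = occurrences-∈ uniq p∈
  ... | no  p∉ = cong length (filter-none (p ≟_)
                   (All.tabulate (λ { x∈ refl → p∉ x∈ })))

  module _ {x y p : U} (p≢x : p ≢ x) (p≢y : p ≢ y) where

    endpoint-false : endpoint C x y p ≡ false
    endpoint-false = dec-false ((p ≟ x) ⊎-dec (p ≟ y)) λ where
      (inj₁ p≡x) → p≢x p≡x
      (inj₂ p≡y) → p≢y p≡y

    listed-∨ : listed C x y p ≡ adjacent x p ∨ adjacent y p
    listed-∨ = trans
      (does-⇔ (mk⇔ (∈-++⁻ (column C x y))
                   λ where (inj₁ p∈) → ∈-++⁺ˡ p∈
                           (inj₂ p∈) → ∈-++⁺ʳ (column C x y) p∈)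
        (p ∈? masterList C x y) ((p ∈? column C x y) ⊎-dec (p ∈? column C y x)))
      (cong₂ _∨_ (does-∈-column p≢y) (does-∈-column p≢x))

    occurrences-+ : occurrences C p (masterList C x y) ≡ bit (adjacent x p) + bit (adjacent y p)
    occurrences-+ = trans (cong length (filter-++ (p ≟_) (column C x y) (column C y x)))
      (trans (length-++ (filter (p ≟_) (column C x y)))
      (cong₂ _+_
        (trans (occurrences-unique (column-unique x y)) (cong bit (does-∈-column p≢y)))
        (trans (occurrences-unique (column-unique y x)) (cong bit (does-∈-column p≢x)))))

  -- Away from `x` and `y`, membership in a column is adjacency, and columns have no repetitions, so
  -- the case distinction depends on five bits only and `pivot-table` settles it. For adjacent `x`
  -- and `y` the right-hand side is the entry of the Schur complement of their block, which is its
  -- own inverse.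
  gcds-pivot : ∀ {x y p q} → p ≢ x → p ≢ y → q ≢ x → q ≢ y → p ≢ q →
    gcdsAdjacent C x y p q ≡
    adjacent p q xor ((adjacent x p ∧ adjacent y q) xor (adjacent y p ∧ adjacent x q))
  gcds-pivot {x} {y} {p} {q} p≢x p≢y q≢x q≢y p≢q
    rewrite endpoint-false p≢x p≢y | endpoint-false q≢x q≢y | dec-false (p ≟ q) p≢q
          | listed-∨ p≢x p≢y | listed-∨ q≢x q≢y
          | does-∈-column {x} p≢y | does-∈-column {y} p≢x
          | does-∈-column {x} q≢y | does-∈-column {y} q≢x
          | occurrences-+ p≢x p≢y | occurrences-+ q≢x q≢y
    = trans
      (pivot-table (adjacent x p) (adjacent y p) (adjacent x q) (adjacent y q) (adjacent p q))
      (xor-comm _ (adjacent p q))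

-- Words, their adjacency, and the deletion of two adjacent letters.

module Words {L : Set} (_≟_ : DecidableEquality L) (even : L → Bool) where

  Even : L → Set
  Even x = even x ≡ true

  -- reach w q: q would be adjacent to a letter put in front of w.
  reach : List L → L → Bool
  reach []      q = false
  reach (x ∷ w) q = if does (x ≟ q) then true else even x ∧ reach w q

  adj : List L → L → L → Bool
  adj []      p q = false
  adj (x ∷ w) p q =
    if does (x ≟ p) then reach w q else if does (x ≟ q) then reach w p else adj w p q

  -- Move w a b w′: a precedes b in w, they are adjacent, and w′ is w without them;
  -- Drop records the letters between a and b, all even.
  data Drop : List L → L → List L → Set where
    here  : ∀ {b w} → Drop (b ∷ w) b w
    there : ∀ {x w b w′} → Even x → Drop w b w′ → Drop (x ∷ w) b (x ∷ w′)

  data Move : List L → L → L → List L → Set where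
    here  : ∀ {a w b w′} → Drop w b w′ → Move (a ∷ w) a b w′
    there : ∀ {x w a b w′} → Move w a b w′ → Move (x ∷ w) a b (x ∷ w′)

  drop-∈ : ∀ {w b w′} → Drop w b w′ → b ∈ w
  drop-∈ here        = here refl
  drop-∈ (there _ d) = there (drop-∈ d)

  move-∈ˡ : ∀ {w a b w′} → Move w a b w′ → a ∈ w
  move-∈ˡ (here _)  = here refl
  move-∈ˡ (there m) = there (move-∈ˡ m)

  move-∈ʳ : ∀ {w a b w′} → Move w a b w′ → b ∈ w
  move-∈ʳ (here d)  = there (drop-∈ d)
  move-∈ʳ (there m) = there (move-∈ʳ m)

  drop-reach : ∀ {w b w′} → Drop w b w′ → reach w b ≡ true
  drop-reach {b = b} here with b ≟ b
  ... | yes _  = refl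
  ... | no b≢b = contradiction refl b≢b
  drop-reach {x ∷ _} {b} (there ev d) with x ≟ b
  ... | yes _ = refl
  ... | no _ rewrite ev = drop-reach d

  -- All letters in front of `b` are even. So `b` is adjacent to each of them, and behind itself it
  -- sees what the front of the word sees once `b` is gone.
  drop-adj : ∀ {w b w′} → Unique w → Drop w b w′ → ∀ {q} → q ≢ b → adj w b q ≡ reach w′ q
  drop-adj {b = b} _ here _ with b ≟ b
  ... | yes _  = refl
  ... | no b≢b = contradiction refl b≢b
  drop-adj {x ∷ _} {b} (fresh ∷ uniq) (there ev d) {q} q≢b with x ≟ b | x ≟ q
  ... | yes x≡b | _     = contradiction x≡b (lookup fresh (drop-∈ d))
  ... | no _    | yes _ = drop-reach d
  ... | no _    | no _ rewrite ev = drop-adj uniq d q≢b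

  -- This is the pivot identity for a letter `a` put in front of `w` and deleted together with `b`:
  -- the row of such an `a` is `reach w`.
  drop-pivot : ∀ {w b w′} → Unique w → Drop w b w′ → ∀ {p q} → p ≢ b → q ≢ b → p ≢ q →
    adj w′ p q ≡ adj w p q xor ((reach w p ∧ adj w b q) xor (adj w b p ∧ reach w q))
  drop-pivot {b ∷ z} _ here {p} {q} p≢b q≢b _ with b ≟ b | b ≟ p | b ≟ q
  ... | no b≢b | _       | _       = contradiction refl b≢b
  ... | yes _  | yes b≡p | _       = contradiction (sym b≡p) p≢b
  ... | yes _  | no _    | yes b≡q = contradiction (sym b≡q) q≢b
  ... | yes _  | no _    | no _    = calc (adj z p q) (even b) (reach z p) (reach z q)
    where
    calc : ∀ e ev r s → e ≡ e xor (((ev ∧ r) ∧ s) xor (r ∧ (ev ∧ s)))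
    calc = solve 4 (λ e ev r s → e := e :+ (((ev :* r) :* s) :+ (r :* (ev :* s)))) refl
  drop-pivot {x ∷ u} {b} (fresh ∷ uniq) (there {w′ = u′} ev d) {p} {q} p≢b q≢b p≢q
    with x ≟ b | x ≟ p | x ≟ q
  ... | yes x≡b | _       | _       = contradiction x≡b (lookup fresh (drop-∈ d))
  ... | no _    | yes x≡p | yes x≡q = contradiction (trans (sym x≡p) x≡q) p≢q
  ... | no _    | yes _   | no _
    rewrite ev | drop-reach d | drop-adj uniq d q≢b = calc (reach u′ q) (reach u q)
    where
    calc : ∀ r s → r ≡ s xor (r xor s)
    calc = solve 2 (λ r s → r := s :+ (r :+ s)) refl
  ... | no _    | no _    | yes _
    rewrite ev | drop-reach d | drop-adj uniq d p≢b = calc (reach u′ p) (reach u p)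
    where
    calc : ∀ r s → r ≡ s xor ((s ∧ true) xor (r ∧ true))
    calc = solve 2 (λ r s → r := s :+ ((s :* con true) :+ (r :* con true))) refl
  ... | no _    | no _    | no _ rewrite ev = drop-pivot uniq d p≢b q≢b p≢q

  -- The pivot identity for a virtual letter `p` in front of the word; its row is `reach w` before
  -- the move and `reach w′` after it.
  move-reach : ∀ {w a b w′} → Unique w → Move w a b w′ → ∀ {q} → q ≢ a → q ≢ b →
    reach w′ q ≡ reach w q xor ((reach w a ∧ adj w b q) xor (reach w b ∧ adj w a q))
  move-reach {a ∷ u} {b = b} {w′} (fresh ∷ uniq) (here d) {q} q≢a q≢b with a ≟ a | a ≟ b | a ≟ q
  ... | no a≢a | _       | _       = contradiction refl a≢a
  ... | yes _  | yes a≡b | _       = contradiction a≡b (lookup fresh (drop-∈ d))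
  ... | yes _  | no _    | yes a≡q = contradiction (sym a≡q) q≢a
  ... | yes _  | no _    | no _
    rewrite drop-reach d | drop-adj uniq d q≢b = calc (reach w′ q) (even a) (reach u q)
    where
    calc : ∀ r ev s → r ≡ (ev ∧ s) xor (r xor ((ev ∧ true) ∧ s))
    calc = solve 3 (λ r ev s → r := (ev :* s) :+ (r :+ ((ev :* con true) :* s))) refl
  move-reach {x ∷ u} {a} {b} {x ∷ u′} (fresh ∷ uniq) (there m) {q} q≢a q≢b
    with x ≟ a | x ≟ b | x ≟ q
  ... | yes x≡a | _       | _     = contradiction x≡a (lookup fresh (move-∈ˡ m))
  ... | no _    | yes x≡b | _     = contradiction x≡b (lookup fresh (move-∈ʳ m))
  ... | no _    | no _    | yes _ = calc (even x) (reach u a) (reach u b)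
    where
    calc : ∀ ev r s → true ≡ true xor (((ev ∧ r) ∧ s) xor ((ev ∧ s) ∧ r))
    calc = solve 3 (λ ev r s → con true := con true :+ (((ev :* r) :* s) :+ ((ev :* s) :* r))) refl
  ... | no _    | no _    | no _  with even x
  -- An odd `x` hides everything behind it, so every term vanishes.
  ...   | false = refl
  ...   | true  = move-reach uniq m q≢a q≢b

  -- The induction peels letters off the front. If `p` or `q` is peeled off, its row is `reach u`
  -- and `move-reach` applies; once `a` is in front, `drop-pivot` does.
  move-pivot : ∀ {w a b w′} → Unique w → Move w a b w′ →
    ∀ {p q} → p ≢ a → p ≢ b → q ≢ a → q ≢ b → p ≢ q →
    adj w′ p q ≡ adj w p q xor ((adj w a p ∧ adj w b q) xor (adj w b p ∧ adj w a q))
  move-pivot {a ∷ u} {b = b} (fresh ∷ uniq) (here d) {p} {q} p≢a p≢b q≢a q≢b p≢q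
    with a ≟ a | a ≟ b | a ≟ p | a ≟ q
  ... | no a≢a | _       | _       | _       = contradiction refl a≢a
  ... | yes _  | yes a≡b | _       | _       = contradiction a≡b (lookup fresh (drop-∈ d))
  ... | yes _  | no _    | yes a≡p | _       = contradiction (sym a≡p) p≢a
  ... | yes _  | no _    | no _    | yes a≡q = contradiction (sym a≡q) q≢a
  ... | yes _  | no _    | no _    | no _    = drop-pivot uniq d p≢b q≢b p≢q
  move-pivot {x ∷ u} {a} {b} {x ∷ u′} (fresh ∷ uniq) (there m) {p} {q} p≢a p≢b q≢a q≢b p≢q
    with x ≟ a | x ≟ b | x ≟ p | x ≟ q
  ... | yes x≡a | _       | _       | _       = contradiction x≡a (lookup fresh (move-∈ˡ m))
  ... | no _    | yes x≡b | _       | _       = contradiction x≡b (lookup fresh (move-∈ʳ m))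
  ... | no _    | no _    | yes x≡p | yes x≡q = contradiction (trans (sym x≡p) x≡q) p≢q
  ... | no _    | no _    | yes _   | no _    = move-reach uniq m q≢a q≢b
  ... | no _    | no _    | no _    | yes _   =
    trans (move-reach uniq m p≢a p≢b)
      (calc (reach u p) (reach u a) (adj u b p) (reach u b) (adj u a p))
    where
    calc : ∀ e r s r′ s′ → e xor ((r ∧ s) xor (r′ ∧ s′)) ≡ e xor ((s′ ∧ r′) xor (s ∧ r))
    calc = solve 5 (λ e r s r′ s′ →
      e :+ ((r :* s) :+ (r′ :* s′)) := e :+ ((s′ :* r′) :+ (s :* r))) refl
  ... | no _    | no _    | no _    | no _    = move-pivot uniq m p≢a p≢b q≢a q≢b p≢q

  drop-↭ : ∀ {w b w′} → Drop w b w′ → w ↭ b ∷ w′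
  drop-↭ here                 = ↭-refl
  drop-↭ (there {x} {b = b} _ d) = ↭-trans (prep x (drop-↭ d)) (swap x b ↭-refl)

  move-↭ : ∀ {w a b w′} → Move w a b w′ → w ↭ a ∷ b ∷ w′
  move-↭ (here {a} d) = prep a (drop-↭ d)
  move-↭ (there {x} {a = a} {b} m) = ↭-trans (prep x (move-↭ m))
    (↭-trans (swap x a ↭-refl) (prep a (swap x b ↭-refl)))

  -- An edge comes with its endpoints in either order, whereas `Move` names them in the order of the
  -- word.
  data Removal (w : List L) (c d : L) (w′ : List L) : Set where
    forward  : Move w c d w′ → Removal w c d w′
    backward : Move w d c w′ → Removal w c d w′

  removal-↭ : ∀ {w c d w′} → Removal w c d w′ → w ↭ c ∷ d ∷ w′
  removal-↭ (forward m)  = move-↭ m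
  removal-↭ {c = c} {d} (backward m) = ↭-trans (move-↭ m) (swap d c ↭-refl)

  removal-unique : ∀ {w c d w′} → Removal w c d w′ → Unique w → Unique (c ∷ d ∷ w′)
  removal-unique r = Permutationₛ.Unique-resp-↭ (setoid L) (↭⇒↭ₛ (removal-↭ r))

  removal-pivot : ∀ {w c d w′} → Unique w → Removal w c d w′ →
    ∀ {p q} → p ≢ c → p ≢ d → q ≢ c → q ≢ d → p ≢ q →
    adj w′ p q ≡ adj w p q xor ((adj w c p ∧ adj w d q) xor (adj w d p ∧ adj w c q))
  removal-pivot uniq (forward m)  p≢c p≢d q≢c q≢d p≢q = move-pivot uniq m p≢c p≢d q≢c q≢d p≢q
  removal-pivot {w} {c} {d} uniq (backward m) {p} {q} p≢c p≢d q≢c q≢d p≢q =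
    trans (move-pivot uniq m p≢d p≢c q≢d q≢c p≢q)
      (cong (adj w p q xor_) (xor-comm (adj w d p ∧ adj w c q) _))

  reach⇒drop : ∀ w {q} → T (reach w q) → ∃[ w′ ] Drop w q w′
  reach⇒drop (x ∷ w) {q} r with x ≟ q
  ... | yes refl = w , here
  ... | no _ with even x in ev
  ...   | true with reach⇒drop w r
  ...     | w′ , d = x ∷ w′ , there ev d

  adj⇒removal : ∀ w {p q} → T (adj w p q) → ∃[ w′ ] Removal w p q w′
  adj⇒removal (x ∷ w) {p} {q} t with x ≟ p
  ... | yes refl with reach⇒drop w t
  ...   | w′ , d = w′ , forward (here d)
  adj⇒removal (x ∷ w) {p} {q} t | no _ with x ≟ q
  ...   | yes refl with reach⇒drop w t
  ...     | w′ , d = w′ , backward (here d)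
  adj⇒removal (x ∷ w) {p} {q} t | no _ | no _ with adj⇒removal w t
  ... | w′ , forward m  = x ∷ w′ , forward (there m)
  ... | w′ , backward m = x ∷ w′ , backward (there m)

  move⇒adj : ∀ {w a b w′} → Unique w → Move w a b w′ → adj w a b ≡ true
  move⇒adj {a = a} _ (here d) with a ≟ a
  ... | yes _  = drop-reach d
  ... | no a≢a = contradiction refl a≢a
  move⇒adj {x ∷ _} {a} {b} (fresh ∷ uniq) (there m) with x ≟ a | x ≟ b
  ... | yes x≡a | _       = contradiction x≡a (lookup fresh (move-∈ˡ m))
  ... | no _    | yes x≡b = contradiction x≡b (lookup fresh (move-∈ʳ m))
  ... | no _    | no _    = move⇒adj uniq m

  -- Consecutive letters have nothing between them, so they are adjacent whatever their parities.
  neighbour : ∀ {w i} → Unique w → i ∈ w →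
    w ≡ i ∷ [] ⊎ (∃[ j ] j ∈ w × i ≢ j × T (adj w i j))
  neighbour {x ∷ []}    _              (here refl) = inj₁ refl
  neighbour {x ∷ y ∷ w} ((x≢y ∷ _) ∷ _) (here refl) = inj₂ (y , there (here refl) , x≢y , adjacent)
    where
    adjacent : T (adj (x ∷ y ∷ w) x y)
    adjacent with x ≟ x | y ≟ y
    ... | yes _  | yes _  = _
    ... | no x≢x | _      = contradiction refl x≢x
    ... | yes _  | no y≢y = contradiction refl y≢y
  neighbour {x ∷ y ∷ w} {i} (fresh ∷ uniq) (there i∈) with neighbour uniq i∈
  ... | inj₁ refl = inj₂ (x , here refl , lookup fresh i∈ ∘ sym , adjacent)
    where
    adjacent : T (adj (x ∷ y ∷ []) y x)
    adjacent with x ≟ y | x ≟ x | y ≟ y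
    ... | yes x≡y | _      | _      = contradiction x≡y (lookup fresh (here refl))
    ... | no _    | yes _  | yes _  = _
    ... | no _    | no x≢x | _      = contradiction refl x≢x
    ... | no _    | yes _  | no y≢y = contradiction refl y≢y
  ... | inj₂ (j , j∈ , i≢j , t) = inj₂ (j , there j∈ , i≢j , adjacent)
    where
    adjacent : T (adj (x ∷ y ∷ w) i j)
    adjacent with x ≟ i | x ≟ j
    ... | yes x≡i | _       = contradiction x≡i (lookup fresh i∈)
    ... | no _    | yes x≡j = contradiction x≡j (lookup fresh j∈)
    ... | no _    | no _    = t

  -- Graphs represented by words.

  module _ {U : Set} (e : L → U) where

    -- The map `e` stays fixed during a play and only the word shrinks. The fields speak of letters
    -- of `w` alone, since `e` need not be injective on other letters.
    record Represents (C : Graph U) (w : List L) : Set where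
      open Graph C using (vertices; adjacent)
      field
        word-unique : Unique w
        sound       : ∀ {i} → i ∈ w → e i ∈ vertices
        complete    : ∀ {v} → v ∈ vertices → ∃[ i ] i ∈ w × v ≡ e i
        injective   : ∀ {i j} → i ∈ w → j ∈ w → e i ≡ e j → i ≡ j
        adjacency   : ∀ {i j} → i ∈ w → j ∈ w → i ≢ j → adjacent (e i) (e j) ≡ adj w i j

    module _ {C : Graph U} {w : List L} (R : Represents C w) where
      open Graph C using (vertices; adjacent; symmetric; irreflexive; incident; Edge)
      open Represents R

      move⇒edge : ∀ {a b w′} → Move w a b w′ → Edge (e a) (e b)
      move⇒edge m with removal-unique (forward m) word-unique
      ... | (a≢b ∷ _) ∷ _ = Equivalence.from T-≡
        (trans (adjacency (move-∈ˡ m) (move-∈ʳ m) a≢b) (move⇒adj word-unique m))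

      edge⇒removal : ∀ {u v} → Edge u v →
        ∃[ c ] ∃[ d ] ∃[ w′ ] (u ≡ e c × v ≡ e d × Removal w c d w′)
      edge⇒removal {u} {v} t
        with complete (incident u v t) | complete (incident v u (subst T (symmetric u v) t))
      ... | c , c∈ , refl | d , d∈ , refl
        with adj⇒removal w (subst T (adjacency c∈ d∈ λ { refl → subst T (irreflexive u) t }) t)
      ... | w′ , r = c , d , w′ , refl , refl , r

      module _ {c d : L} {w′ : List L} (r : Removal w c d w′) where
        private
          x y : U
          x = e c
          y = e d
          H : Graph U
          H = gcds C x y
          dist : Unique (c ∷ d ∷ w′)
          dist = removal-unique r word-unique
          c∈ : c ∈ w
          c∈ = ∈-resp-↭ (↭-sym (removal-↭ r)) (here refl)
          d∈ : d ∈ w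
          d∈ = ∈-resp-↭ (↭-sym (removal-↭ r)) (there (here refl))
          w′⊆w : ∀ {i} → i ∈ w′ → i ∈ w
          w′⊆w i∈ = ∈-resp-↭ (↭-sym (removal-↭ r)) (there (there i∈))
          i≢c : ∀ {i} → i ∈ w′ → i ≢ c
          i≢c i∈ with dist
          ... | (_ ∷ f) ∷ _ = lookup f i∈ ∘ sym
          i≢d : ∀ {i} → i ∈ w′ → i ≢ d
          i≢d i∈ with dist
          ... | _ ∷ f ∷ _ = lookup f i∈ ∘ sym
          e≢x : ∀ {i} → i ∈ w′ → e i ≢ x
          e≢x i∈ = i≢c i∈ ∘ injective (w′⊆w i∈) c∈
          e≢y : ∀ {i} → i ∈ w′ → e i ≢ y
          e≢y i∈ = i≢d i∈ ∘ injective (w′⊆w i∈) d∈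
          w′-unique : Unique w′
          w′-unique with dist
          ... | _ ∷ _ ∷ u = u

          adjacency′ : ∀ {i j} → i ∈ w′ → j ∈ w′ → i ≢ j →
                       gcdsAdjacent C x y (e i) (e j) ≡ adj w′ i j
          adjacency′ {i} {j} i∈ j∈ i≢j = begin
            gcdsAdjacent C x y (e i) (e j)
              ≡⟨ gcds-pivot C (e≢x i∈) (e≢y i∈) (e≢x j∈) (e≢y j∈)
                   (i≢j ∘ injective (w′⊆w i∈) (w′⊆w j∈)) ⟩
            adjacent (e i) (e j) xor
              ((adjacent x (e i) ∧ adjacent y (e j)) xor (adjacent y (e i) ∧ adjacent x (e j)))
              ≡⟨ cong₂ _xor_ (adjacency (w′⊆w i∈) (w′⊆w j∈) i≢j) (cong₂ _xor_
                   (cong₂ _∧_ (adjacency c∈ (w′⊆w i∈) (i≢c i∈ ∘ sym))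
                              (adjacency d∈ (w′⊆w j∈) (i≢d j∈ ∘ sym)))
                   (cong₂ _∧_ (adjacency d∈ (w′⊆w i∈) (i≢d i∈ ∘ sym))
                              (adjacency c∈ (w′⊆w j∈) (i≢c j∈ ∘ sym)))) ⟩
            adj w i j xor ((adj w c i ∧ adj w d j) xor (adj w d i ∧ adj w c j))
              ≡⟨ removal-pivot word-unique r (i≢c i∈) (i≢d i∈) (i≢c j∈) (i≢d j∈) i≢j ⟨
            adj w′ i j ∎
            where open ≡-Reasoning

          complete′ : ∀ {v} → v ∈ vertices → v ≢ x → v ≢ y → ∃[ i ] i ∈ w′ × v ≡ e i
          complete′ v∈ v≢x v≢y with complete v∈
          ... | i , i∈ , refl with ∈-resp-↭ (removal-↭ r) i∈
          ...   | here refl                = contradiction refl v≢x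
          ...   | there (here refl)        = contradiction refl v≢y
          ...   | there (there i∈′)        = i , i∈′ , refl

          column-avoids : ∀ {a b v} → v ∈ column C a b → v ∈ vertices × v ≢ a × v ≢ b
          column-avoids {a} v∈ with column-∈ C v∈
          ... | v∈V , t , v≢b = v∈V , (λ { refl → subst T (irreflexive a) t }) , v≢b

          masterList-∈ : ∀ {v} → v ∈ masterList C x y → ∃[ i ] i ∈ w′ × v ≡ e i
          masterList-∈ v∈ with ∈-++⁻ (column C x y) v∈
          ... | inj₁ v∈l with column-avoids v∈l
          ...   | v∈V , v≢x , v≢y = complete′ v∈V v≢x v≢y
          masterList-∈ v∈ | inj₂ v∈r with column-avoids v∈r
          ...   | v∈V , v≢y , v≢x = complete′ v∈V v≢x v≢y

          -- In a word of several letters each has a neighbour, so none is isolated. If one letter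
          -- is left, the master list can contain only its vertex, which is the exception made in
          -- `Deleted`.
          retained : ∀ {i} → i ∈ w′ → ¬ Deleted C x y (e i)
          retained i∈ (inj₁ (inj₁ ei≡x)) = e≢x i∈ ei≡x
          retained i∈ (inj₁ (inj₂ ei≡y)) = e≢y i∈ ei≡y
          retained {i} i∈ (inj₂ (_ , isolated , ¬only)) with neighbour w′-unique i∈
          ... | inj₁ w′≡[i] = ¬only (All.tabulate only)
            where
            only : ∀ {v} → v ∈ masterList C x y → v ≡ e i
            only v∈ with masterList-∈ v∈
            ... | j , j∈ , refl with subst (j ∈_) w′≡[i] j∈
            ...   | here refl = refl
          ... | inj₂ (j , j∈ , i≢j , t) =
            lookup isolated (sound (w′⊆w j∈)) (subst T (sym (adjacency′ i∈ j∈ i≢j)) t)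

        -- A move thus deletes its two endpoints and nothing else, and plays can be followed on
        -- words.
        represents-gcds₂ : Represents (gcds₂ C x y) w′
        represents-gcds₂ = record
          { word-unique = w′-unique
          ; sound       = λ i∈ → ∈-filter⁺ (λ v → ¬? (deleted? C x y v))
                            (sound (w′⊆w i∈)) (retained i∈)
          ; complete    = complete″
          ; injective   = λ i∈ j∈ → injective (w′⊆w i∈) (w′⊆w j∈)
          ; adjacency   = adjacency′
          }
          where
          complete″ : ∀ {v} → v ∈ Graph.vertices (gcds₂ C x y) → ∃[ i ] i ∈ w′ × v ≡ e i
          complete″ v∈ with ∈-filter⁻ (λ v → ¬? (deleted? C x y v)) {xs = vertices} v∈
          ... | v∈V , ¬del = complete′ v∈V (¬del ∘ inj₁ ∘ inj₁) (¬del ∘ inj₁ ∘ inj₂)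

-- Strategies played on words.

module Strategies {L : Set} (_≟_ : DecidableEquality L) (even : L → Bool)
  {U : Set} (e : L → U) (B : Pred U 0ℓ) where
  open Words _≟_ even

  Odd : L → Set
  Odd x = even x ≡ false

  even⇒¬odd : ∀ {x} → Even x → Odd x → ⊥
  even⇒¬odd ev od with trans (sym ev) od
  ... | ()

  -- Quantifying over all represented graphs makes winning a property of the word.
  Winning : Player → Player → List L → Set₁
  Winning p next w = ∀ {C} → Represents e C w → WinningStrategy p next (C , B)

  winning-choose : ∀ {p w a b w′} → Move w a b w′ → Winning p (opponent p) w′ → Winning p p w
  winning-choose m win R = choose _ _ (move⇒edge e R m) (win (represents-gcds₂ e R (forward m)))

  winning-respond : ∀ {p x y w} →
    (∀ {a b w′} → Move (x ∷ y ∷ w) a b w′ → Winning p p w′) → Winning p (opponent p) (x ∷ y ∷ w)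
  winning-respond {p} {x} {y} {w} win {C} R = respond
    -- The first two letters are always adjacent, so play is not over.
    (λ edgeless → edgeless _ _ (move⇒edge e R (here here))) respond′
    where
    respond′ : ∀ u v → Graph.Edge C u v → WinningStrategy p p (gcds₂ C u v , B)
    respond′ u v t with edge⇒removal e R t
    ... | _ , _ , _ , refl , refl , forward m  = win m (represents-gcds₂ e R (forward m))
    ... | _ , _ , _ , refl , refl , backward m = win m (represents-gcds₂ e R (backward m))

  singleton-edgeless : ∀ {C x} → Represents e C (x ∷ []) → Edgeless C
  singleton-edgeless R u v t with edge⇒removal e R t
  ... | _ , _ , _ , _ , _ , forward (here ())
  ... | _ , _ , _ , _ , _ , forward (there ())
  ... | _ , _ , _ , _ , _ , backward (here ())
  ... | _ , _ , _ , _ , _ , backward (there ())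

  singleton-ONE : ∀ {x next} → B (e x) → Winning ONE next (x ∷ [])
  singleton-ONE {x} bx {C} R =
    finished (singleton-edgeless R) (nonempty (sound (here refl)) , All.tabulate favorable)
    where
    open Represents R
    nonempty : ∀ {v} {vs : List U} → v ∈ vs → vs ≢ []
    nonempty () refl
    favorable : ∀ {v} → v ∈ Graph.vertices C → B v
    favorable v∈ with complete v∈
    ... | _ , here refl , refl = bx

  singleton-TWO : ∀ {x next} → ¬ B (e x) → Winning TWO next (x ∷ [])
  singleton-TWO ¬bx R = finished (singleton-edgeless R)
    λ { (_ , all) → ¬bx (lookup all (Represents.sound R (here refl))) }

  -- The counting strategy of TWO.

  -- Alternating true w: the letters of w in even positions (counted from 1) are even and
  -- w has odd length.  This is what makes every word of three letters a triangle.
  data Alternating : Bool → List L → Set where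
    []  : Alternating false []
    any : ∀ {x w} → Alternating false w → Alternating true (x ∷ w)
    evn : ∀ {x w} → Even x → Alternating true w → Alternating false (x ∷ w)

  -- The letters in front of `b` change between free places and places for even letters, which is
  -- harmless because they are all even; those behind `b` keep their kind of place.
  drop-alternating : ∀ {s w b w′} → Drop w b w′ → Alternating s w → Alternating (not s) w′
  drop-alternating here         (any alt)   = alt
  drop-alternating here         (evn _ alt) = alt
  drop-alternating (there ev d) (any alt)   = evn ev (drop-alternating d alt)
  drop-alternating (there ev d) (evn _ alt) = any (drop-alternating d alt)

  move-alternating : ∀ {s w a b w′} → Move w a b w′ → Alternating s w → Alternating s w′
  move-alternating (here d)  (any alt)    = drop-alternating d alt
  move-alternating (here d)  (evn _ alt)  = drop-alternating d alt
  move-alternating (there m) (any alt)    = any (move-alternating m alt)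
  move-alternating (there m) (evn ev alt) = evn ev (move-alternating m alt)

  -- At most k letters are favorable; spend does not assert B, which need not be decidable.
  data Sparse : ℕ → List L → Set where
    []    : ∀ {k} → Sparse k []
    free  : ∀ {k x w} → ¬ B (e x) → Sparse k w → Sparse k (x ∷ w)
    spend : ∀ {k x w} → Sparse k w → Sparse (suc k) (x ∷ w)

  weaken : ∀ {k w} → Sparse k w → Sparse (suc k) w
  weaken []          = []
  weaken (free ¬b s) = free ¬b (weaken s)
  weaken (spend s)   = spend (weaken s)

  sparse-tail : ∀ {k x w} → Sparse k (x ∷ w) → Sparse k w
  sparse-tail (free _ s) = s
  sparse-tail (spend s)  = weaken s

  drop-sparse : ∀ {k w b w′} → Drop w b w′ → Sparse k w → Sparse k w′
  drop-sparse here        s           = sparse-tail s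
  drop-sparse (there _ d) (free ¬b s) = free ¬b (drop-sparse d s)
  drop-sparse (there _ d) (spend s)   = spend (drop-sparse d s)

  move-sparse : ∀ {k w a b w′} → Move w a b w′ → Sparse k w → Sparse k w′
  move-sparse (here d)  s           = drop-sparse d (sparse-tail s)
  move-sparse (there m) (free ¬b s) = free ¬b (move-sparse m s)
  move-sparse (there m) (spend s)   = spend (move-sparse m s)

  -- The first letter counted as favorable is deleted with a letter next to it. If no letter is
  -- counted, the last two letters go.
  sparser-move : ∀ {k x y w} → Sparse (suc k) (x ∷ y ∷ w) →
    ∃[ a ] ∃[ b ] ∃[ w′ ] Move (x ∷ y ∷ w) a b w′ × Sparse k w′
  sparser-move (spend s)                    = _ , _ , _ , here here , sparse-tail s
  sparser-move (free _ (spend s))           = _ , _ , _ , here here , s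
  sparser-move (free _ (free _ []))         = _ , _ , _ , here here , []
  sparser-move (free ¬b s@(free _ (free _ _))) with sparser-move s
  ... | _ , _ , _ , m , s′ = _ , _ , _ , there m , free ¬b s′
  sparser-move (free ¬b s@(free _ (spend _))) with sparser-move s
  ... | _ , _ , _ , m , s′ = _ , _ , _ , there m , free ¬b s′

  move-length : ∀ {n w a b w′} → Move w a b w′ → length w ≡ 2 + n → length w′ ≡ n
  move-length m eq = ℕ.suc-injective (ℕ.suc-injective (trans (sym (↭-length (move-↭ m))) eq))

  mutual
    -- A round of two moves takes four letters, and the move of TWO lowers the bound by one. So `k`
    -- rounds lead to three letters of which at most two are favorable.
    TWO-moves-last-first : ∀ k {w} → Alternating true w → Sparse (2 + k) w →
      length w ≡ 3 + k * 4 → Winning TWO TWO w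
    TWO-moves-last-first zero (any (evn _ (any []))) (free ¬b _) _ =
      winning-choose (there (here here)) (singleton-TWO ¬b)
    TWO-moves-last-first zero (any (evn ev (any []))) (spend (free ¬b _)) _ =
      -- The outer two letters are adjacent across the even middle one, which is kept.
      winning-choose (here (there ev here)) (singleton-TWO ¬b)
    TWO-moves-last-first zero (any (evn _ (any []))) (spend (spend (free ¬b _))) _ =
      winning-choose (here here) (singleton-TWO ¬b)
    TWO-moves-last-first (suc k) {_ ∷ _ ∷ _} alt s len with sparser-move s
    ... | _ , _ , _ , m , s′ = winning-choose m
      (TWO-moves-last-second k (move-alternating m alt) s′ (move-length m len))

    TWO-moves-last-second : ∀ k {w} → Alternating true w → Sparse (2 + k) w →
      length w ≡ 5 + k * 4 → Winning TWO ONE w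
    TWO-moves-last-second k {_ ∷ _ ∷ _} alt s len = winning-respond λ m →
      TWO-moves-last-first k (move-alternating m alt) (move-sparse m s) (move-length m len)

  -- The replies of ONE.

  -- Good k is the pattern of 𝒢 (2 + 2k): o F o F (o u o F)^k o with o odd, u and F even
  -- and F favorable.  The parity of the first and the last letter does not affect
  -- adjacency and is left free; the replies make use of this.
  data Tail : ℕ → List L → Set where
    last : ∀ {o} → Tail 0 (o ∷ [])
    more : ∀ {k o u o′ f w} → Odd o → Even u → Odd o′ → Even f → B (e f) → Tail k w →
           Tail (suc k) (o ∷ u ∷ o′ ∷ f ∷ w)

  data Good (k : ℕ) : List L → Set where
    good : ∀ {o₀ f₁ o₁ f₂ w} → Even f₁ → B (e f₁) → Odd o₁ → Even f₂ → B (e f₂) → Tail k w →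
           Good k (o₀ ∷ f₁ ∷ o₁ ∷ f₂ ∷ w)

  -- When a move takes the head of the following tail, the letter `o` of the block in front can
  -- replace it.
  rehead : ∀ {k o h w} → Odd o → Tail k (h ∷ w) → Tail k (o ∷ w)
  rehead _  last                   = last
  rehead od (more _ eu oo′ ef bf t) = more od eu oo′ ef bf t

  Reply : (List L → Set) → List L → Set
  Reply P w = ∃[ c ] ∃[ d ] ∃[ w′ ] Move w c d w′ × P w′

  -- No move crosses the head of a tail: it is odd, or nothing stands behind it.
  tail-head-blocks : ∀ {k h w b w′} {X : Set} → Tail k (h ∷ w) → Even h → Drop w b w′ → X
  tail-head-blocks (more od _ _ _ _ _) ev _ = contradiction od (even⇒¬odd ev)

  -- The reply clears the rest of the block in which the move starts. If the move also took the head
  -- of the next part, `o` is left over as the new head.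
  tail-reply : ∀ {k w a b w′} → Tail (suc k) w → Move w a b w′ → Reply (Tail k) w′
  tail-reply (more _ _ _ _ _ t) (here here)             = _ , _ , _ , here here , t
  tail-reply (more _ _ _ _ _ t) (here (there _ here))   = _ , _ , _ , here here , t
  tail-reply (more _ _ oo′ _ _ _) (here (there _ (there ev _))) = contradiction oo′ (even⇒¬odd ev)
  tail-reply (more _ _ _ _ _ t) (there (here here))     = _ , _ , _ , here here , t
  tail-reply (more _ _ oo′ _ _ _) (there (here (there ev _))) = contradiction oo′ (even⇒¬odd ev)
  tail-reply (more _ _ _ _ _ t) (there (there (here here))) = _ , _ , _ , here here , t
  tail-reply (more oo _ _ _ _ t) (there (there (here (there _ here)))) =
    _ , _ , _ , there (here here) , rehead oo t
  tail-reply (more _ _ _ _ _ t) (there (there (here (there _ (there ev d))))) =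
    tail-head-blocks t ev d
  tail-reply (more oo _ _ _ _ t) (there (there (there (here here)))) =
    _ , _ , _ , there (here here) , rehead oo t
  tail-reply (more _ _ _ _ _ t) (there (there (there (here (there ev d))))) =
    tail-head-blocks t ev d
  tail-reply (more _ _ _ _ _ last) (there (there (there (there (here ())))))
  tail-reply (more _ _ _ _ _ last) (there (there (there (there (there ())))))
  tail-reply (more oo eu oo′ ef bf t@(more _ _ _ _ _ _)) (there (there (there (there m))))
    with tail-reply t m
  ... | _ , _ , _ , m′ , t′ =
    _ , _ , _ , there (there (there (there m′))) , more oo eu oo′ ef bf t′

  -- If the move starts in the first four letters, `f₁` or `f₂` ends up in second place and the `f`
  -- of the first block in fourth place. Otherwise `tail-reply` answers it.
  good-reply : ∀ {k w a b w′} → Good (suc k) w → Move w a b w′ → Reply (Good k) w′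
  good-reply (good e₁ b₁ o₁ e₂ b₂ (more oo eu oo′ ef bf t)) (here here) =
    _ , _ , _ , there (there (here here)) , good e₂ b₂ oo′ ef bf t
  -- Here the even `f₁` becomes the head, whose parity is free.
  good-reply (good e₁ b₁ o₁ e₂ b₂ (more oo eu oo′ ef bf t)) (here (there _ here)) =
    _ , _ , _ , there (there (here here)) , good e₂ b₂ oo′ ef bf t
  good-reply (good e₁ b₁ o₁ e₂ b₂ t) (here (there _ (there ev _))) = contradiction o₁ (even⇒¬odd ev)
  good-reply (good e₁ b₁ o₁ e₂ b₂ (more oo eu oo′ ef bf t)) (there (here here)) =
    _ , _ , _ , there (there (here here)) , good e₂ b₂ oo′ ef bf t
  good-reply (good e₁ b₁ o₁ e₂ b₂ t) (there (here (there ev _))) = contradiction o₁ (even⇒¬odd ev)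
  good-reply (good e₁ b₁ o₁ e₂ b₂ (more oo eu oo′ ef bf t)) (there (there (here here))) =
    _ , _ , _ , there (there (here here)) , good e₁ b₁ oo′ ef bf t
  good-reply (good e₁ b₁ o₁ e₂ b₂ (more oo eu oo′ ef bf t)) (there (there (here (there _ here)))) =
    _ , _ , _ , there (there (here here)) , good e₁ b₁ oo′ ef bf t
  good-reply (good _ _ _ _ _ t) (there (there (here (there _ (there ev d))))) =
    tail-head-blocks t ev d
  good-reply (good e₁ b₁ o₁ e₂ b₂ (more oo eu oo′ ef bf t)) (there (there (there (here here)))) =
    _ , _ , _ , there (there (there (here here))) , good e₁ b₁ o₁ ef bf t
  good-reply (good _ _ _ _ _ t) (there (there (there (here (there ev d))))) =
    tail-head-blocks t ev d
  good-reply (good e₁ b₁ o₁ e₂ b₂ t) (there (there (there (there m)))) with tail-reply t m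
  ... | _ , _ , _ , m′ , t′ =
    _ , _ , _ , there (there (there (there m′))) , good e₁ b₁ o₁ e₂ b₂ t′

  -- The odd `o₁` separates `f₁` from `f₂`, so a move leaves one of them; the other two letters left
  -- are adjacent and are deleted in reply.
  good-last-reply : ∀ {w a b w′} → Good 0 w → Move w a b w′ →
    Reply (λ v → ∃[ x ] v ≡ x ∷ [] × B (e x)) w′
  good-last-reply (good e₁ b₁ o₁ e₂ b₂ last) (here here) =
    _ , _ , _ , here (there e₂ here) , _ , refl , b₂
  good-last-reply (good e₁ b₁ o₁ e₂ b₂ last) (here (there _ here)) =
    _ , _ , _ , there (here here) , _ , refl , b₁
  good-last-reply (good e₁ b₁ o₁ e₂ b₂ last) (here (there _ (there ev _))) =
    contradiction o₁ (even⇒¬odd ev)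
  good-last-reply (good e₁ b₁ o₁ e₂ b₂ last) (there (here here)) =
    _ , _ , _ , here (there e₂ here) , _ , refl , b₂
  good-last-reply (good e₁ b₁ o₁ e₂ b₂ last) (there (here (there ev _))) =
    contradiction o₁ (even⇒¬odd ev)
  good-last-reply (good e₁ b₁ o₁ e₂ b₂ last) (there (there (here here))) =
    _ , _ , _ , here (there e₁ here) , _ , refl , b₁
  good-last-reply (good e₁ b₁ o₁ e₂ b₂ last) (there (there (here (there _ here)))) =
    _ , _ , _ , here (there e₁ here) , _ , refl , b₁
  good-last-reply (good e₁ b₁ o₁ e₂ b₂ last) (there (there (here (there _ (there _ ())))))
  good-last-reply (good e₁ b₁ o₁ e₂ b₂ last) (there (there (there (here here)))) =
    _ , _ , _ , here (there e₁ here) , _ , refl , b₁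
  good-last-reply (good e₁ b₁ o₁ e₂ b₂ last) (there (there (there (here (there _ ())))))
  good-last-reply (good e₁ b₁ o₁ e₂ b₂ last) (there (there (there (there (here ())))))
  good-last-reply (good e₁ b₁ o₁ e₂ b₂ last) (there (there (there (there (there ())))))

  good-wins : ∀ k {w} → Good k w → Winning ONE TWO w
  good-wins zero g@(good _ _ _ _ _ _) = winning-respond answer
    where
    answer : ∀ {a b w′} → Move _ a b w′ → Winning ONE ONE w′
    answer m with good-last-reply g m
    ... | _ , _ , _ , m′ , _ , refl , b = winning-choose m′ (singleton-ONE b)
  good-wins (suc k) g@(good _ _ _ _ _ _) = winning-respond answer
    where
    answer : ∀ {a b w′} → Move _ a b w′ → Winning ONE ONE w′
    answer m with good-reply g m
    ... | _ , _ , _ , m′ , g′ = winning-choose m′ (good-wins k g′)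

-- The graph `𝒢 n` as a word of consecutive numbers.

even : ℕ → Bool
even zero    = true
even (suc n) = not (even n)

-- In contrast to `applyUpTo suc`, the tail is again of the same form.
interval : ℕ → ℕ → List ℕ
interval c zero    = []
interval c (suc m) = c ∷ interval (suc c) m

applyUpTo-interval : ∀ (f : ℕ → ℕ) c m → (∀ i → f i ≡ i + c) → applyUpTo f m ≡ interval c m
applyUpTo-interval f c zero    f≗ = refl
applyUpTo-interval f c (suc m) f≗ =
  cong₂ _∷_ (f≗ 0) (applyUpTo-interval (f ∘ suc) (suc c) m
    (λ i → trans (f≗ (suc i)) (sym (ℕ.+-suc i c))))

length-interval : ∀ c m → length (interval c m) ≡ m
length-interval c zero    = refl
length-interval c (suc m) = cong suc (length-interval (suc c) m)

-- Equality of labels is kept abstract, since does (c ℕ.≟ p) unfolds to c ≡ᵇ p and then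
-- escapes with-abstraction.
module ChainAdjacency (_≟_ : DecidableEquality ℕ) where
  open Words _≟_ even using (adj)
  open DecMembership ℕ._≟_ using (_∈?_)

  corner : ℕ → ℕ → Bool
  corner c p = does (c ≟ p) ∨ does (suc c ≟ p) ∨ does (suc (suc c) ≟ p)

  does-flip : ∀ p q → does (p ℕ.≟ q) ≡ does (q ≟ p)
  does-flip p q = does-⇔ (mk⇔ sym sym) (p ℕ.≟ q) (q ≟ p)

  does-∈-corners : ∀ c p → does (p ∈? corners c) ≡ corner c p
  does-∈-corners c p
    rewrite ℕ.+-comm c 1 | ℕ.+-comm c 2
          | does-flip p c | does-flip p (suc c) | does-flip p (suc (suc c))
          | ∨-identityʳ (does (suc (suc c) ≟ p)) = refl

  triangle-corner : ∀ c {p q} → p ≢ q → triangle c p q ≡ corner c p ∧ corner c q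
  triangle-corner c {p} {q} p≢q
    rewrite does-∈-corners c p | does-∈-corners c q | dec-false (p ℕ.≟ q) p≢q
          | ∧-identityʳ (corner c q) = refl

  corner-below : ∀ {c p} → p < c → corner c p ≡ false
  corner-below {c} {p} p<c = cong₂ _∨_ (dec-false (c ≟ p) (ℕ.>⇒≢ p<c)) $
    cong₂ _∨_ (dec-false (suc c ≟ p) (ℕ.>⇒≢ (ℕ.m<n⇒m<1+n p<c)))
              (dec-false (suc (suc c) ≟ p) (ℕ.>⇒≢ (ℕ.m<n⇒m<1+n (ℕ.m<n⇒m<1+n p<c))))

  -- The chain built from its front, as `adj` reads a word; `𝒢-adjacent` adds triangles at the back.
  triangles : ℕ → ℕ → ℕ → ℕ → Bool
  triangles c zero    p q = false
  triangles c (suc n) p q = triangle c p q ∨ triangles (suc (suc c)) n p q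

  triangles-belowˡ : ∀ c n {p q} → p ≢ q → p < c → triangles c n p q ≡ false
  triangles-belowˡ c zero    _ _ = refl
  triangles-belowˡ c (suc n) p≢q p<c rewrite triangle-corner c p≢q | corner-below p<c =
    triangles-belowˡ (suc (suc c)) n p≢q (ℕ.m<n⇒m<1+n (ℕ.m<n⇒m<1+n p<c))

  triangles-belowʳ : ∀ c n {p q} → p ≢ q → q < c → triangles c n p q ≡ false
  triangles-belowʳ c zero    _ _ = refl
  triangles-belowʳ c (suc n) {p} p≢q q<c
    rewrite triangle-corner c p≢q | corner-below q<c | ∧-zeroʳ (corner c p) =
    triangles-belowʳ (suc (suc c)) n p≢q (ℕ.m<n⇒m<1+n (ℕ.m<n⇒m<1+n q<c))

  triangles-snoc : ∀ c n p q →
    triangles c (suc n) p q ≡ triangles c n p q ∨ triangle (2 * n + c) p q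
  triangles-snoc c zero    p q = ∨-identityʳ _
  triangles-snoc c (suc n) p q = trans
    (cong (triangle c p q ∨_) (trans (triangles-snoc (suc (suc c)) n p q)
      (cong (λ d → triangles (suc (suc c)) n p q ∨ triangle d p q) (shift n c))))
    (sym (∨-assoc (triangle c p q) _ _))
    where
    shift : ∀ n c → 2 * n + suc (suc c) ≡ 2 * suc n + c
    shift = solve-∀

  𝒢-triangles : ∀ n p q → 𝒢-adjacent (suc n) p q ≡ triangles 1 (suc n) p q
  𝒢-triangles zero    p q = sym (∨-identityʳ _)
  𝒢-triangles (suc n) p q =
    trans (cong (_∨ _) (𝒢-triangles n p q)) (sym (triangles-snoc 1 (suc n) p q))

  -- As `c` is odd, so is `c + 2`: the first two letters see nothing beyond it, and later triangles
  -- contain neither of them. If `p` and `q` avoid both, the first triangle offers only `c + 2`,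
  -- which cannot be both `p` and `q`.
  adj-interval : ∀ n c {p q} → even c ≡ false → p ≢ q →
    adj (interval c (1 + n * 2)) p q ≡ triangles c n p q
  adj-interval zero c {p} {q} _ _ with c ≟ p | c ≟ q
  ... | yes _ | _     = refl
  ... | no _  | yes _ = refl
  ... | no _  | no _  = refl
  adj-interval (suc n) c {p} {q} odd p≢q
    rewrite triangle-corner c p≢q with c ≟ p | suc c ≟ p | c ≟ q | suc c ≟ q
  ... | yes c≡p  | _        | yes c≡q  | _       = contradiction (trans (sym c≡p) c≡q) p≢q
  ... | _        | yes c≡p  | _        | yes c≡q = contradiction (trans (sym c≡p) c≡q) p≢q
  ... | yes refl | yes c≡p  | _        | _       = contradiction c≡p ℕ.1+n≢n
  ... | _        | _        | yes refl | yes c≡q = contradiction c≡q ℕ.1+n≢n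
  ... | yes refl | no _     | no _     | yes _   = refl
  ... | yes refl | no _     | no _     | no _
    rewrite odd | triangles-belowˡ (suc (suc c)) n p≢q (ℕ.m<n⇒m<1+n (ℕ.n<1+n c))
    with suc (suc c) ≟ q
  ...   | yes _ = refl
  ...   | no _  = refl
  adj-interval (suc n) c {p} {q} odd p≢q
      | no _     | yes refl | yes _    | no _    = refl
  adj-interval (suc n) c {p} {q} odd p≢q
      | no _     | yes refl | no _     | no _
    rewrite odd | triangles-belowˡ (suc (suc c)) n p≢q (ℕ.n<1+n (suc c))
    with suc (suc c) ≟ q
  ...   | yes _ = refl
  ...   | no _  = refl
  adj-interval (suc n) c {p} {q} odd p≢q
      | no _     | no _     | yes refl | no _
    rewrite odd | triangles-belowʳ (suc (suc c)) n p≢q (ℕ.m<n⇒m<1+n (ℕ.n<1+n c))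
    with suc (suc c) ≟ p
  ...   | yes _ = refl
  ...   | no _  = refl
  adj-interval (suc n) c {p} {q} odd p≢q
      | no _     | no _     | no _     | yes refl
    rewrite odd | triangles-belowʳ (suc (suc c)) n p≢q (ℕ.n<1+n (suc c))
    with suc (suc c) ≟ p
  ...   | yes _ = refl
  ...   | no _  = refl
  adj-interval (suc n) c {p} {q} odd p≢q
      | no _     | no _     | no _     | no _
    = trans (adj-interval n (suc (suc c)) (trans (not-involutive (even c)) odd) p≢q)
        (cong (_∨ triangles (suc (suc c)) n p q) (sym apart))
    where
    apart : does (suc (suc c) ≟ p) ∧ does (suc (suc c) ≟ q) ≡ false
    apart with suc (suc c) ≟ p | suc (suc c) ≟ q
    ... | yes c≡p | yes c≡q = contradiction (trans (sym c≡p) c≡q) p≢q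
    ... | yes _   | no _    = refl
    ... | no _    | _       = refl

residue : ∀ r j → r % 4 ≢ 0 → (r + j * 4) % 4 ≢ 0
residue r j r%4≢0 = r%4≢0 ∘ trans (sym ([m+kn]%n≡m%n r j 4))

even-*4 : ∀ j → even (j * 4) ≡ true
even-*4 zero    = refl
even-*4 (suc j) rewrite even-*4 j = refl

-- The patterns of the initial word.

module _ {U : Set} (e : ℕ → U) (B : Pred U 0ℓ) where
  open Words ℕ._≟_ even using (Move; here; there)
  open Strategies ℕ._≟_ even e B

  last-two-move : ∀ c m → ∃[ a ] ∃[ b ] Move (interval c (2 + m)) a b (interval c m)
  last-two-move c zero    = _ , _ , here here
  last-two-move c (suc m) with last-two-move (suc c) m
  ... | _ , _ , move = _ , _ , there move

  -- Odd numbers occupy the free places; the hypothesis makes the number after the last letter even,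
  -- as `[]` demands.
  alternating-interval : ∀ c m → even (c + m) ≡ true → Alternating (not (even c)) (interval c m)
  alternating-interval c zero    ev rewrite trans (cong even (sym (ℕ.+-identityʳ c))) ev = []
  alternating-interval c (suc m) ev
    with even c in eq | alternating-interval (suc c) m (trans (cong even (sym (ℕ.+-suc c m))) ev)
  ... | true  | alt = evn eq alt
  ... | false | alt = any alt

  tail-interval : ∀ k j →
    (∀ {i} → i ∈ interval (5 + j * 4) (1 + k * 4) → i % 4 ≡ 0 → B (e i)) →
    Tail k (interval (5 + j * 4) (1 + k * 4))
  tail-interval zero    j _   = last
  tail-interval (suc k) j fav = more odd₅ even₆ odd₇ even₈
    -- The favorable letter of the block is `8 + j * 4`, that is, `(2 + j) * 4`.
    (fav (there (there (there (here refl)))) (m*n%n≡0 (2 + j) 4))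
    (tail-interval k (suc j) (λ i∈ → fav (there (there (there (there i∈))))))
    where
    odd₅ : even (5 + j * 4) ≡ false
    odd₅ rewrite even-*4 j = refl
    even₆ : even (6 + j * 4) ≡ true
    even₆ rewrite even-*4 j = refl
    odd₇ : even (7 + j * 4) ≡ false
    odd₇ rewrite even-*4 j = refl
    even₈ : even (8 + j * 4) ≡ true
    even₈ rewrite even-*4 j = refl

  good-interval : ∀ k → B (e 2) →
    (∀ {i} → i ∈ interval 1 (5 + k * 4) → i % 4 ≡ 0 → B (e i)) → Good k (interval 1 (5 + k * 4))
  -- The letters `f₁` and `f₂` are 2 and 4.
  good-interval k b₂ fav = good refl b₂ refl refl (fav (there (there (there (here refl)))) refl)
    (tail-interval k 0 (λ i∈ → fav (there (there (there (there i∈))))))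

  sparse-tail-interval : ∀ k j →
    (∀ {i} → i ≢ 2 → i % 4 ≢ 0 → ¬ B (e i)) →
    Sparse k (interval (5 + j * 4) (1 + k * 4))
  sparse-tail-interval zero    j unfav =
    free (unfav (λ ()) (residue 5 j (λ ()))) []
  sparse-tail-interval (suc k) j unfav =
    free (unfav (λ ()) (residue 5 j (λ ())))
    (free (unfav (λ ()) (residue 6 j (λ ())))
    (free (unfav (λ ()) (residue 7 j (λ ())))
    (spend (sparse-tail-interval k (suc j) unfav))))

  -- The labels 2 and 4 spend two, and each of the `k` later blocks spends one on its multiple of 4.
  sparse-interval : ∀ k →
    (∀ {i} → i ≢ 2 → i % 4 ≢ 0 → ¬ B (e i)) →
    Sparse (2 + k) (interval 1 (5 + k * 4))
  sparse-interval k unfav =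
    free (unfav (λ ()) (λ ())) (spend
    (free (unfav (λ ()) (λ ())) (spend
    (sparse-tail-interval k 0 unfav))))

-- Transport along the isomorphism.

vertex-≡ : ∀ {U : Set} (G : Graph U) {u v : Graph.Vertex G} → proj₁ u ≡ proj₁ v → u ≡ v
vertex-≡ G {u , u∈} {_ , v∈} refl = cong (u ,_) (unique⇒irrelevant (Graph.unique G) u∈ v∈)

module InitialPosition {U : Set} (F : Graph U) (B : Pred U 0ℓ) (n : ℕ)
  (iso : (F , B) ≅ (𝒢 (suc n) , 𝖠 (suc n))) where
  open _≅_ iso using (bijection; f; edges; favorable)
  open Inverse bijection using (from; strictlyInverseˡ; strictlyInverseʳ)
  open Words ℕ._≟_ even using (adj; Represents)
  open ChainAdjacency ℕ._≟_ using (triangles; 𝒢-triangles; adj-interval)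
  open DecMembership ℕ._≟_ using (_∈?_)

  word : List ℕ
  word = interval 1 (2 * suc n + 1)

  G : Graph ℕ
  G = 𝒢 (suc n)

  vertices-word : Graph.vertices G ≡ word
  vertices-word = applyUpTo-interval suc 1 (2 * suc n + 1) (λ i → ℕ.+-comm 1 i)

  -- Labels that are no vertices go to the place of the unfavorable label 1, so that
  -- ¬B-place holds for all labels.
  place : ℕ → U
  place i with i ∈? Graph.vertices G
  ... | yes i∈ = proj₁ (from (i , i∈))
  ... | no  _  = proj₁ (from (1 , here refl))

  place-≡ : ∀ {i} (i∈ : i ∈ Graph.vertices G) → place i ≡ proj₁ (from (i , i∈))
  place-≡ {i} i∈ with i ∈? Graph.vertices G
  ... | yes _ = cong (proj₁ ∘ from) (vertex-≡ G refl)
  ... | no i∉ = contradiction i∈ i∉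

  vertex : ∀ {i} → i ∈ word → Graph.Vertex G
  vertex {i} i∈ = i , subst (i ∈_) (sym vertices-word) i∈

  place-vertex : ∀ {i} (i∈ : i ∈ word) → place i ≡ proj₁ (from (vertex i∈))
  place-vertex i∈ = place-≡ (proj₂ (vertex i∈))

  place-f : ∀ u → place (proj₁ (f u)) ≡ proj₁ u
  place-f u = trans (place-≡ (proj₂ (f u))) (cong proj₁ (strictlyInverseʳ u))

  adjacency : ∀ {i j} → i ∈ word → j ∈ word → i ≢ j →
    Graph.adjacent F (place i) (place j) ≡ adj word i j
  adjacency {i} {j} i∈ j∈ i≢j = begin
    Graph.adjacent F (place i) (place j)
      ≡⟨ cong₂ (Graph.adjacent F) (place-vertex i∈) (place-vertex j∈) ⟩
    Graph.adjacent F (proj₁ u) (proj₁ v)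
      ≡⟨ does-⇔ (edges u v) (T? _) (T? _) ⟩
    𝒢-adjacent (suc n) (proj₁ (f u)) (proj₁ (f v))
      ≡⟨ cong₂ (λ u v → 𝒢-adjacent (suc n) (proj₁ u) (proj₁ v))
           (strictlyInverseˡ (vertex i∈)) (strictlyInverseˡ (vertex j∈)) ⟩
    𝒢-adjacent (suc n) i j
      ≡⟨ 𝒢-triangles n i j ⟩
    triangles 1 (suc n) i j
      ≡⟨ adj-interval (suc n) 1 refl i≢j ⟨
    adj (interval 1 (1 + suc n * 2)) i j
      ≡⟨ cong (λ m → adj (interval 1 m) i j) (double n) ⟩
    adj word i j ∎
    where
    open ≡-Reasoning
    u v : Graph.Vertex F
    u = from (vertex i∈)
    v = from (vertex j∈)
    double : ∀ n → 1 + suc n * 2 ≡ 2 * suc n + 1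
    double = solve-∀

  represents : Represents place F word
  represents = record
    { word-unique = subst Unique vertices-word (Graph.unique G)
    ; sound       = λ i∈ → subst (_∈ Graph.vertices F) (sym (place-vertex i∈))
                             (proj₂ (from (vertex i∈)))
    ; complete    = λ {v} v∈ → proj₁ (f (v , v∈))
                      , subst (proj₁ (f (v , v∈)) ∈_) vertices-word (proj₂ (f (v , v∈)))
                      , sym (place-f (v , v∈))
    ; injective   = λ i∈ j∈ eq → cong proj₁ (begin
        vertex i∈            ≡⟨ strictlyInverseˡ (vertex i∈) ⟨
        f (from (vertex i∈)) ≡⟨ cong f (vertex-≡ F
                                  (trans (sym (place-vertex i∈)) (trans eq (place-vertex j∈)))) ⟩
        f (from (vertex j∈)) ≡⟨ strictlyInverseˡ (vertex j∈) ⟩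
        vertex j∈            ∎)
    ; adjacency   = adjacency
    }
    where open ≡-Reasoning

  B-place : ∀ {i} → 𝖠 (suc n) i → B (place i)
  B-place {i} a with Equivalence.to (favorable i) a
  ... | u , b , refl = subst B (sym (place-f u)) b

  B-place-multiple : ∀ {i} → i ∈ word → i % 4 ≡ 0 → B (place i)
  B-place-multiple i∈ i%4≡0 = B-place (inj₂ (proj₂ (vertex i∈) , i%4≡0))

  ¬B-place : ∀ {i} → i ≢ 2 → i % 4 ≢ 0 → ¬ B (place i)
  ¬B-place {i} i≢2 i%4≢0 b with i ∈? Graph.vertices G
  ... | yes i∈ with Equivalence.from (favorable i)
                      (from (i , i∈) , b , cong proj₁ (strictlyInverseˡ (i , i∈)))
  ...   | inj₁ i≡2         = i≢2 i≡2
  ...   | inj₂ (_ , i%4≡0) = i%4≢0 i%4≡0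
  ¬B-place {i} i≢2 i%4≢0 b | no _
    with Equivalence.from (favorable 1)
           (from (1 , here refl) , b , cong proj₁ (strictlyInverseˡ (1 , here refl)))
  ... | inj₁ ()
  ... | inj₂ (_ , ())

  -- Lengths such as `5 + k * 4` unfold into blocks of four letters, which `2 * suc n + 1` does not.
  module _ {m : ℕ} (size : 2 * suc n + 1 ≡ m) where

    word-interval : ∀ {i} → i ∈ interval 1 m → i ∈ word
    word-interval {i} = subst (λ m → i ∈ interval 1 m) (sym size)

    represents-interval : Represents place F (interval 1 m)
    represents-interval = subst (λ m → Represents place F (interval 1 m)) size represents

-- Even and odd `n`.

module _ {U : Set} (F : Graph U) (B : Pred U 0ℓ) where

  even-P-position : ∀ k → (F , B) ≅ (𝒢 (2 + k * 2) , 𝖠 (2 + k * 2)) → P-position (F , B)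
  even-P-position k iso = λ where
      ONE → TWO-moves-last-second k (alternating-interval place B 1 (5 + k * 4) even-end)
              (sparse-interval place B k ¬B-place)
              (length-interval 1 (5 + k * 4)) (represents-interval (size k))
      TWO → good-wins k
              (good-interval place B k (B-place (inj₁ refl))
                (B-place-multiple ∘ word-interval (size k)))
              (represents-interval (size k))
    where
    open InitialPosition F B (1 + k * 2) iso
    open Strategies ℕ._≟_ even place B
    size : ∀ k → 2 * (2 + k * 2) + 1 ≡ 5 + k * 4
    size = solve-∀
    even-end : even (6 + k * 4) ≡ true
    even-end rewrite even-*4 k = refl

  odd-N-position : ∀ k → (F , B) ≅ (𝒢 (1 + k * 2) , 𝖠 (1 + k * 2)) → N-position (F , B)
  odd-N-position k iso = λ where
      ONE → ONE-wins k (B-place (inj₁ refl))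
              (B-place-multiple ∘ word-interval (size k)) (represents-interval (size k))
      TWO → TWO-moves-last-first k (alternating-interval place B 1 (3 + k * 4) even-end)
              -- The word is that of the next even case without its last two labels, so the bound
              -- found there carries over.
              (move-sparse (proj₂ (proj₂ (last-two-move place B 1 (3 + k * 4))))
                (sparse-interval place B k ¬B-place))
              (length-interval 1 (3 + k * 4)) (represents-interval (size k))
    where
    open InitialPosition F B (k * 2) iso
    open Words ℕ._≟_ even using (here; there; move-↭)
    open Strategies ℕ._≟_ even place B
    size : ∀ k → 2 * (1 + k * 2) + 1 ≡ 3 + k * 4
    size = solve-∀
    even-end : even (4 + k * 4) ≡ true
    even-end rewrite even-*4 k = refl
    ONE-wins : ∀ k → B (place 2) →
      (∀ {i} → i ∈ interval 1 (3 + k * 4) → i % 4 ≡ 0 → B (place i)) →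
      Winning ONE ONE (interval 1 (3 + k * 4))
    -- In the triangle, ONE deletes 1 and 3 and keeps 2.
    ONE-wins zero    b₂ _   = winning-choose (here (there refl here)) (singleton-ONE b₂)
    -- This opening leaves the word of `𝒢 (2 + k * 2)` with TWO to move.
    ONE-wins (suc k) b₂ fav with last-two-move place B 1 (5 + k * 4)
    ... | _ , _ , m = winning-choose m (good-wins k (good-interval place B k b₂
      (λ i∈ → fav (∈-resp-↭ (↭-sym (move-↭ m)) (there (there i∈))))))

parity : ∀ n → (∃[ k ] n ≡ k * 2) ⊎ (∃[ k ] n ≡ 1 + k * 2)
parity zero = inj₁ (0 , refl)
parity (suc n) with parity n
... | inj₁ (k , refl) = inj₂ (k , refl)
... | inj₂ (k , refl) = inj₁ (suc k , refl)

theorem5 : {U : Set} (F : Graph U) (B : Pred U 0ℓ) (n : ℕ) .{{_ : NonZero n}} →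
    (F , B) ≅ (𝒢 n , 𝖠 n) →
    (2 ∤ n → N-position (F , B)) × (2 ∣ n → P-position (F , B))
theorem5 F B n iso with parity n
... | inj₁ (zero , refl)  = contradiction refl (ℕ.≢-nonZero⁻¹ 0)
... | inj₁ (suc k , refl) =
  (λ odd → contradiction (divides (suc k) refl) odd) , λ _ → even-P-position F B k iso
... | inj₂ (k , refl) =
  (λ _ → odd-N-position F B k iso) , λ 2∣n → contradiction (∣1⇒≡1 (2∣1 2∣n)) λ ()
  where
  2∣1 : 2 ∣ 1 + k * 2 → 2 ∣ 1
  2∣1 2∣n = ∣m+n∣m⇒∣n (subst (2 ∣_) (ℕ.+-comm 1 (k * 2)) 2∣n) (divides k refl)
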